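{- If $\mathcal{F} \subseteq \binom{[n]}{2}$ is $(3,4)$-conditionally intersecting but is not intersecting, then \[ |\mathcal{F}| \leq n-2, \] and equality holds if and only if $\mathcal{F}$ is a twin 2-star.
   Context: $[n]=\{1,\ldots,n\}$ and $\binom{[n]}{2}$ is the family of all $2$-element subsets of $[n]$. A family $\mathcal{F}$ is $(3,4)$-conditionally intersecting if, for all distinct sets $A_1,A_2,A_3\in\mathcal{F}$, $A_1\cap A_2\cap A_3\neq\emptyset$ whenever $|A_1\cup A_2\cup A_3|\leq 4$. A family $\mathcal{F}$ is intersecting if $A\cap B\neq\emptyset$ for all $A,B\in\mathcal{F}$. A twin 2-star on $[n]$ is any family $\mathcal{F} \subseteq \binom{[n]}{2}$ consisting, for some distinct fixed $x,y \in [n]$, of $n-2$ unordered pairs of the form $\{z,z'\}$ with $z\in [n]\setminus\{x,y\}$ and $z'\in\{x,y\}$, such that each element $z\in [n]\setminus\{x,y\}$ appears in exactly one member of $\mathcal{F}$. -}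

module Defs where

open import Data.Fin using (Fin)
open import Data.Fin.Subset using (Subset; ∣_∣; _∩_; _∪_; ⁅_⁆; Nonempty) renaming (_∈_ to _∈ₛ_)
open import Data.List using (List; length)
open import Data.List.Membership.Propositional using () renaming (_∈_ to _∈ₗ_)
open import Data.List.Relation.Unary.Unique.Propositional using (Unique)
open import Data.Nat using (ℕ; _∸_; _≤_)
open import Data.Product using (_×_; ∃!; ∃-syntax)
open import Data.Sum using (_⊎_)
open import Relation.Binary.PropositionalEquality using (_≡_; _≢_)

-- A set of subsets of Fin n, listed without repetition, so that its
-- cardinality is the length of the list.
record Family (n : ℕ) : Set where
  constructor family
  field
    members : List (Subset n)
    unique  : Unique members

open Family public

infix 4 _∈_

_∈_ : ∀ {n} → Subset n → Family n → Set
A ∈ F = A ∈ₗ members F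

card : ∀ {n} → Family n → ℕ
card F = length (members F)

ConsistsOfPairs : ∀ {n} → Family n → Set
ConsistsOfPairs F = ∀ {A} → A ∈ F → ∣ A ∣ ≡ 2

Intersecting : ∀ {n} → Family n → Set
Intersecting F = ∀ {A B} → A ∈ F → B ∈ F → Nonempty (A ∩ B)

[3,4]-ConditionallyIntersecting : ∀ {n} → Family n → Set
[3,4]-ConditionallyIntersecting F =
  ∀ {A₁ A₂ A₃} → A₁ ∈ F → A₂ ∈ F → A₃ ∈ F →
  A₁ ≢ A₂ → A₁ ≢ A₃ → A₂ ≢ A₃ →
  ∣ A₁ ∪ A₂ ∪ A₃ ∣ ≤ 4 → Nonempty (A₁ ∩ A₂ ∩ A₃)

-- All the elements z may be joined to the same one of x and y, so a
-- twin 2-star can be an ordinary star with an isolated point.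
record IsTwin2StarAt {n : ℕ} (x y : Fin n) (F : Family n) : Set where
  field
    x≢y   : x ≢ y
    pairs : ConsistsOfPairs F
    size  : card F ≡ n ∸ 2
    form  : ∀ {A} → A ∈ F →
            ∃[ z ] ∃[ z′ ] (z ≢ x × z ≢ y) × (z′ ≡ x ⊎ z′ ≡ y) × A ≡ ⁅ z ⁆ ∪ ⁅ z′ ⁆
    once  : ∀ z → z ≢ x → z ≢ y → ∃! _≡_ λ A → A ∈ F × z ∈ₛ A

IsTwin2Star : ∀ {n} → Family n → Set
IsTwin2Star F = ∃[ x ] ∃[ y ] IsTwin2StarAt x y F

{-# OPTIONS --safe #-}
-- A path or triangle of three edges spans at most four vertices and has no
-- common vertex, so every edge has an end of degree one, its leaf; call its
-- other end its centre.  Leaves of distinct edges are distinct, and no centre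
-- is a leaf.  Two disjoint edges have distinct centres x and y, so the leaves
-- inject into [n] \ {x, y}, which gives |F| ≤ n - 2.  In case of equality
-- every vertex other than x and y is a leaf, so every centre is x or y.
module Submission where

open import Data.Nat using (ℕ; zero; suc; _+_; _∸_; _≤_)
open import Data.Nat.Properties as ℕ using (suc-injective)
open import Data.Product using (_×_; _,_; ∃!; ∃₂; ∃-syntax)
open import Data.Sum using (_⊎_; inj₁; inj₂)
open import Data.Fin using (Fin; zero; suc; _≟_)
open import Data.Fin.Properties using (any?; injective⇒≤)
open import Data.Fin.Subset
  using (Subset; ⁅_⁆; ∣_∣; _∩_; _∪_; ⊥; _⊆_; Nonempty; inside; outside)
  renaming (_∈_ to _∈ₛ_)
open import Data.Fin.Subset.Properties
open import Data.List using (List; lookup)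
open import Data.List.Membership.Propositional.Properties using (∈-lookup)
import Data.List.Relation.Unary.All as All
open import Data.List.Relation.Unary.AllPairs using (_∷_)
open import Data.List.Relation.Unary.Any using (index)
open import Data.List.Relation.Unary.Any.Properties using (lookup-index)
open import Data.List.Relation.Unary.Unique.Propositional using (Unique)
open import Data.Vec using ([]; _∷_)
import Data.Empty as Empty
import Data.Vec.Functional as Vector
open import Function.Base using (_∘_)
open import Function.Bundles using (_⇔_; mk⇔)
open import Function.Definitions using (Injective)
open import Relation.Binary.PropositionalEquality
  using (_≡_; _≢_; refl; sym; trans; cong; cong₂; subst; subst₂; ≢-sym)
open import Relation.Nullary using (¬_; yes; no; contradiction; ¬?; _×-dec_)
open import Relation.Nullary.Decidable using (decidable-stable)
open import Defs

private
  variable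
    m n : ℕ

-- Injective maps between finite sets.

lookup-injective : ∀ {a} {A : Set a} {xs : List A} → Unique xs →
                   Injective _≡_ _≡_ (lookup xs)
lookup-injective (x∉ ∷ u) {zero}  {zero}  eq = refl
lookup-injective (x∉ ∷ u) {zero}  {suc j} eq = contradiction eq (All.lookup x∉ (∈-lookup j))
lookup-injective (x∉ ∷ u) {suc i} {zero}  eq = contradiction (sym eq) (All.lookup x∉ (∈-lookup i))
lookup-injective (x∉ ∷ u) {suc i} {suc j} eq = cong suc (lookup-injective u eq)

-- Serves to adjoin further vertices to the injective family of leaves: first the two centres, then
-- a vertex assumed not to be a leaf.
∷-injective : ∀ {x} {f : Fin m → Fin n} → (∀ i → x ≢ f i) →
              Injective _≡_ _≡_ f → Injective _≡_ _≡_ (x Vector.∷ f)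
∷-injective x∉ inj {zero}  {zero}  eq = refl
∷-injective x∉ inj {zero}  {suc j} eq = contradiction eq (x∉ j)
∷-injective x∉ inj {suc i} {zero}  eq = contradiction (sym eq) (x∉ i)
∷-injective x∉ inj {suc i} {suc j} eq = cong suc (inj eq)

-- Subsets with at most two elements, and the size of a union.

∣p∣≡0⇒p≡⊥ : ∀ {p : Subset n} → ∣ p ∣ ≡ 0 → p ≡ ⊥
∣p∣≡0⇒p≡⊥ {p = []}          eq = refl
∣p∣≡0⇒p≡⊥ {p = outside ∷ p} eq = cong (outside ∷_) (∣p∣≡0⇒p≡⊥ eq)

∣p∣≡1⇒singleton : ∀ {p : Subset n} → ∣ p ∣ ≡ 1 → ∃[ x ] p ≡ ⁅ x ⁆
∣p∣≡1⇒singleton {p = inside  ∷ p} eq = zero , cong (inside ∷_) (∣p∣≡0⇒p≡⊥ (suc-injective eq))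
∣p∣≡1⇒singleton {p = outside ∷ p} eq with x , refl ← ∣p∣≡1⇒singleton {p = p} eq = suc x , refl

∣p∣≡2⇒pair : ∀ {p : Subset n} → ∣ p ∣ ≡ 2 → ∃₂ λ x y → x ≢ y × p ≡ ⁅ x ⁆ ∪ ⁅ y ⁆
∣p∣≡2⇒pair {p = inside ∷ p} eq with y , refl ← ∣p∣≡1⇒singleton {p = p} (suc-injective eq) =
  zero , suc y , (λ ()) , cong (inside ∷_) (sym (∪-identityˡ ⁅ y ⁆))
∣p∣≡2⇒pair {p = outside ∷ p} eq with x , y , x≢y , refl ← ∣p∣≡2⇒pair {p = p} eq =
  suc x , suc y , (λ { refl → x≢y refl }) , refl

x∈⁅x⁆∪⁅y⁆ : ∀ (x y : Fin n) → x ∈ₛ ⁅ x ⁆ ∪ ⁅ y ⁆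
x∈⁅x⁆∪⁅y⁆ x y = x∈p∪q⁺ (inj₁ (x∈⁅x⁆ x))

y∈⁅x⁆∪⁅y⁆ : ∀ (x y : Fin n) → y ∈ₛ ⁅ x ⁆ ∪ ⁅ y ⁆
y∈⁅x⁆∪⁅y⁆ x y = x∈p∪q⁺ (inj₂ (x∈⁅x⁆ y))

∈-pair⁻ : ∀ (x y : Fin n) {z} → z ∈ₛ ⁅ x ⁆ ∪ ⁅ y ⁆ → z ≡ x ⊎ z ≡ y
∈-pair⁻ x y z∈ with x∈p∪q⁻ ⁅ x ⁆ ⁅ y ⁆ z∈
... | inj₁ z∈x = inj₁ (x∈⁅y⁆⇒x≡y x z∈x)
... | inj₂ z∈y = inj₂ (x∈⁅y⁆⇒x≡y y z∈y)

-- Once `p` is written with elements `a` and `b`, the distinct members `x` and `y` must be these two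
-- in one order or the other.
pair-determined : ∀ {p : Subset n} {x y} → ∣ p ∣ ≡ 2 → x ≢ y → x ∈ₛ p → y ∈ₛ p →
                  p ≡ ⁅ x ⁆ ∪ ⁅ y ⁆
pair-determined {p = p} {x} {y} ∣p∣≡2 x≢y x∈p y∈p
  with a , b , _ , refl ← ∣p∣≡2⇒pair {p = p} ∣p∣≡2
  with ∈-pair⁻ a b x∈p | ∈-pair⁻ a b y∈p
... | inj₁ refl | inj₁ refl = contradiction refl x≢y
... | inj₁ refl | inj₂ refl = refl
... | inj₂ refl | inj₁ refl = ∪-comm ⁅ a ⁆ ⁅ b ⁆
... | inj₂ refl | inj₂ refl = contradiction refl x≢y

∣p∪q∣≤∣p∣+∣q∣ : ∀ (p q : Subset n) → ∣ p ∪ q ∣ ≤ ∣ p ∣ + ∣ q ∣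
∣p∪q∣≤∣p∣+∣q∣ []            []            = ℕ.≤-refl
∣p∪q∣≤∣p∣+∣q∣ (outside ∷ p) (outside ∷ q) = ∣p∪q∣≤∣p∣+∣q∣ p q
∣p∪q∣≤∣p∣+∣q∣ (outside ∷ p) (inside  ∷ q) =
  ℕ.≤-trans (ℕ.+-monoʳ-≤ 1 (∣p∪q∣≤∣p∣+∣q∣ p q)) (ℕ.≤-reflexive (sym (ℕ.+-suc ∣ p ∣ ∣ q ∣)))
∣p∪q∣≤∣p∣+∣q∣ (inside  ∷ p) (outside ∷ q) = ℕ.+-monoʳ-≤ 1 (∣p∪q∣≤∣p∣+∣q∣ p q)
∣p∪q∣≤∣p∣+∣q∣ (inside  ∷ p) (inside  ∷ q) =
  ℕ.+-monoʳ-≤ 1 (ℕ.≤-trans (∣p∪q∣≤∣p∣+∣q∣ p q) (ℕ.+-monoʳ-≤ ∣ p ∣ (ℕ.n≤1+n ∣ q ∣)))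

-- Edges with an end of degree one.

edge : ∀ (F : Family n) → Fin (card F) → Subset n
edge F = lookup (members F)

-- Edges are named by position in the list, and `degree-one` compares positions rather than sets, so
-- that the leaf map is directly injective on `Fin (card F)`.
record Pendant (F : Family n) (i : Fin (card F)) : Set where
  field
    leaf centre : Fin n
    leaf≢centre : leaf ≢ centre
    ends        : edge F i ≡ ⁅ leaf ⁆ ∪ ⁅ centre ⁆
    degree-one  : ∀ {j} → leaf ∈ₛ edge F j → j ≡ i

  leaf∈edge : leaf ∈ₛ edge F i
  leaf∈edge = subst (leaf ∈ₛ_) (sym ends) (x∈⁅x⁆∪⁅y⁆ leaf centre)

  centre∈edge : centre ∈ₛ edge F i
  centre∈edge = subst (centre ∈ₛ_) (sym ends) (y∈⁅x⁆∪⁅y⁆ leaf centre)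

module _ (F : Family n) (pairs : ConsistsOfPairs F) (cond : [3,4]-ConditionallyIntersecting F) where

  private
    e : Fin (card F) → Subset n
    e = edge F

    e-injective : Injective _≡_ _≡_ e
    e-injective = lookup-injective (unique F)

    ∣e∣≡2 : ∀ i → ∣ e i ∣ ≡ 2
    ∣e∣≡2 i = pairs (∈-lookup i)

  edge-determined : ∀ {i j x y} → x ≢ y → x ∈ₛ e i → y ∈ₛ e i → x ∈ₛ e j → y ∈ₛ e j → j ≡ i
  edge-determined {i} {j} x≢y x∈i y∈i x∈j y∈j = e-injective
    (trans (pair-determined (∣e∣≡2 j) x≢y x∈j y∈j)
           (sym (pair-determined (∣e∣≡2 i) x≢y x∈i y∈i)))

  -- Such edges `e j`, `e i`, `e k` would form a path, or a triangle if `e j` and `e k` meet, which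
  -- the condition on three edges forbids.
  ends-not-both-shared : ∀ {i j k x y} → x ≢ y → x ∈ₛ e i → y ∈ₛ e i →
                         x ∈ₛ e j → j ≢ i → y ∈ₛ e k → k ≢ i → Empty.⊥
  ends-not-both-shared {i} {j} {k} {x} {y} x≢y x∈i y∈i x∈j j≢i y∈k k≢i = no-common-vertex
    (cond (∈-lookup i) (∈-lookup j) (∈-lookup k)
          (≢-sym j≢i ∘ e-injective) (≢-sym k≢i ∘ e-injective) (j≢k ∘ e-injective) small)
    where
    j≢k : j ≢ k
    j≢k refl = j≢i (edge-determined x≢y x∈i y∈i x∈j y∈k)

    end : ∀ {z} → z ∈ₛ e i → z ≡ x ⊎ z ≡ y
    end = ∈-pair⁻ x y ∘ subst (_ ∈ₛ_) (pair-determined (∣e∣≡2 i) x≢y x∈i y∈i)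

    -- Both ends of `e i` already lie in the other two edges, which brings the bound on the union
    -- from six down to four.
    union⊆ : e i ∪ e j ∪ e k ⊆ e j ∪ e k
    union⊆ z∈ with x∈p∪q⁻ (e i) (e j ∪ e k) z∈
    ... | inj₂ z∈jk = z∈jk
    ... | inj₁ z∈i with end z∈i
    ...   | inj₁ refl = x∈p∪q⁺ (inj₁ x∈j)
    ...   | inj₂ refl = x∈p∪q⁺ (inj₂ y∈k)

    small : ∣ e i ∪ e j ∪ e k ∣ ≤ 4
    small = begin
      ∣ e i ∪ e j ∪ e k ∣ ≤⟨ p⊆q⇒∣p∣≤∣q∣ union⊆ ⟩
      ∣ e j ∪ e k ∣       ≤⟨ ∣p∪q∣≤∣p∣+∣q∣ (e j) (e k) ⟩
      ∣ e j ∣ + ∣ e k ∣   ≡⟨ cong₂ _+_ (∣e∣≡2 j) (∣e∣≡2 k) ⟩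
      4                   ∎
      where open ℕ.≤-Reasoning

    no-common-vertex : ¬ Nonempty (e i ∩ e j ∩ e k)
    no-common-vertex (t , t∈)
      with t∈i , t∈jk ← x∈p∩q⁻ (e i) (e j ∩ e k) t∈
      with t∈j , t∈k ← x∈p∩q⁻ (e j) (e k) t∈jk
      with end t∈i
    -- A common vertex is an end of `e i`. If it is `x`, then `e k` contains both ends and equals
    -- `e i`; if it is `y`, the same happens to `e j`.
    ... | inj₁ refl = k≢i (edge-determined x≢y x∈i y∈i t∈k y∈k)
    ... | inj₂ refl = j≢i (edge-determined x≢y x∈i y∈i x∈j t∈j)

  -- An end that lies in no other edge is taken as the leaf, `x` being tried first; by
  -- `ends-not-both-shared` one of the two ends qualifies.
  pendant : ∀ i → Pendant F i
  pendant i
    with x , y , x≢y , ei≡ ← ∣p∣≡2⇒pair {p = e i} (∣e∣≡2 i)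
    with any? (λ j → x ∈? e j ×-dec ¬? (j ≟ i)) | any? (λ k → y ∈? e k ×-dec ¬? (k ≟ i))
  ... | no x-alone | _ = record
    { leaf = x ; centre = y ; leaf≢centre = x≢y ; ends = ei≡
    ; degree-one = λ {j} x∈j → decidable-stable (j ≟ i) λ j≢i → x-alone (j , x∈j , j≢i) }
  ... | yes _ | no y-alone = record
    { leaf = y ; centre = x ; leaf≢centre = ≢-sym x≢y ; ends = trans ei≡ (∪-comm ⁅ x ⁆ ⁅ y ⁆)
    ; degree-one = λ {j} y∈j → decidable-stable (j ≟ i) λ j≢i → y-alone (j , y∈j , j≢i) }
  ... | yes (j , x∈j , j≢i) | yes (k , y∈k , k≢i) = Empty.⊥-elim
    (ends-not-both-shared x≢y
      (subst (x ∈ₛ_) (sym ei≡) (x∈⁅x⁆∪⁅y⁆ x y)) (subst (y ∈ₛ_) (sym ei≡) (y∈⁅x⁆∪⁅y⁆ x y))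
      x∈j j≢i y∈k k≢i)

  leaf : Fin (card F) → Fin n
  leaf i = Pendant.leaf (pendant i)

  centre : Fin (card F) → Fin n
  centre i = Pendant.centre (pendant i)

  private module P i = Pendant (pendant i)

  leaf-injective : Injective _≡_ _≡_ leaf
  leaf-injective {i} {j} eq = P.degree-one j (subst (_∈ₛ e i) eq (P.leaf∈edge i))

  -- If the centre of `e i` were the leaf of `e j`, degree one would force `i` and `j` to agree, and
  -- the two ends of a single edge would coincide.
  centre≢leaf : ∀ i j → centre i ≢ leaf j
  centre≢leaf i j eq with refl ← P.degree-one j (subst (_∈ₛ e i) eq (P.centre∈edge i)) =
    P.leaf≢centre i (sym eq)

  -- A failed universal statement yields a witness here because the positions are finitely many and
  -- nonemptiness is decidable.
  disjoint-edges : ¬ Intersecting F → ∃₂ λ i j → ¬ Nonempty (e i ∩ e j)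
  disjoint-edges ¬int
    with any? (λ i → any? (λ j → ¬? (nonempty? (e i ∩ e j))))
  ... | yes disjoint = disjoint
  ... | no none = Empty.⊥-elim (¬int int)
    where
    int : Intersecting F
    int A∈F B∈F = subst₂ (λ A B → Nonempty (A ∩ B)) (sym (lookup-index A∈F)) (sym (lookup-index B∈F))
      (decidable-stable (nonempty? _) λ empty → none (index A∈F , index B∈F , empty))

  -- The bound and the case of equality.

  module _ {i₀ j₀ : Fin (card F)} (disjoint : ¬ Nonempty (e i₀ ∩ e j₀)) where

    private
      x y : Fin n
      x = centre i₀
      y = centre j₀

    centres-distinct : x ≢ y
    centres-distinct x≡y = disjoint
      (x , x∈p∩q⁺ (P.centre∈edge i₀ , subst (_∈ₛ e j₀) (sym x≡y) (P.centre∈edge j₀)))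

    centres∷leaves-injective : Injective _≡_ _≡_ (x Vector.∷ y Vector.∷ leaf)
    centres∷leaves-injective = ∷-injective
      (λ { zero → centres-distinct ; (suc i) → centre≢leaf i₀ i })
      (∷-injective (centre≢leaf j₀) leaf-injective)

    2+card≤n : 2 + card F ≤ n
    2+card≤n = injective⇒≤ centres∷leaves-injective

    card≤n∸2 : card F ≤ n ∸ 2
    card≤n∸2 = ℕ.∸-monoˡ-≤ 2 2+card≤n

    -- A vertex `z` that is missed could be adjoined to the centres and leaves, giving `3 + card F`
    -- distinct vertices where equality leaves room for only `2 + card F`.
    leaf-surjective : card F ≡ n ∸ 2 → ∀ z → z ≢ x → z ≢ y → ∃[ i ] leaf i ≡ z
    leaf-surjective size z z≢x z≢y with any? (λ i → leaf i ≟ z)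
    ... | yes z-leaf = z-leaf
    ... | no ¬leaf = contradiction
      (injective⇒≤ (∷-injective
        (λ { zero → z≢x ; (suc zero) → z≢y ; (suc (suc i)) z≡ → ¬leaf (i , sym z≡) })
        centres∷leaves-injective))
      -- The bound `2+card≤n` gives `2 ≤ n`, so the truncated subtraction is exact and `2 + card F`
      -- equals `n`.
      (ℕ.<-irrefl (trans (cong (2 +_) size) (ℕ.m+[n∸m]≡n (ℕ.m+n≤o⇒m≤o 2 2+card≤n))))

    isTwin2StarAt : card F ≡ n ∸ 2 → IsTwin2StarAt x y F
    isTwin2StarAt size = record
      { x≢y = centres-distinct ; pairs = pairs ; size = size ; form = form ; once = once }
      where
      centre-x⊎y : ∀ i → centre i ≡ x ⊎ centre i ≡ y
      centre-x⊎y i with centre i ≟ x | centre i ≟ y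
      ... | yes ≡x | _      = inj₁ ≡x
      ... | no _   | yes ≡y = inj₂ ≡y
      -- A centre other than `x` and `y` would be a leaf by surjectivity, which no centre is.
      ... | no ≢x  | no ≢y  with j , eq ← leaf-surjective size _ ≢x ≢y =
        contradiction (sym eq) (centre≢leaf i j)

      form : ∀ {A} → A ∈ F →
             ∃[ z ] ∃[ z′ ] (z ≢ x × z ≢ y) × (z′ ≡ x ⊎ z′ ≡ y) × A ≡ ⁅ z ⁆ ∪ ⁅ z′ ⁆
      form A∈F = leaf i , centre i , (centre≢leaf i₀ i ∘ sym , centre≢leaf j₀ i ∘ sym) ,
                 centre-x⊎y i , trans (lookup-index A∈F) (P.ends i)
        where i = index A∈F

      once : ∀ z → z ≢ x → z ≢ y → ∃! _≡_ λ A → A ∈ F × z ∈ₛ A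
      -- Here `z` is the leaf of some `e i`, and its degree one identifies every member containing
      -- it with `e i`.
      once z z≢x z≢y with i , refl ← leaf-surjective size z z≢x z≢y =
        e i , (∈-lookup i , P.leaf∈edge i) , λ (B∈F , z∈B) →
          trans (cong e (sym (P.degree-one i (subst (_ ∈ₛ_) (lookup-index B∈F) z∈B))))
                (sym (lookup-index B∈F))

proposition14 : ∀ (n : ℕ) (F : Family n) → ConsistsOfPairs F → [3,4]-ConditionallyIntersecting F → ¬ Intersecting F →
    (card F ≤ n ∸ 2) × (card F ≡ n ∸ 2 ⇔ IsTwin2Star F)
proposition14 n F pairs cond ¬int with i , j , disjoint ← disjoint-edges F pairs cond ¬int =
  card≤n∸2 F pairs cond disjoint ,
  mk⇔ (λ size → _ , _ , isTwin2StarAt F pairs cond disjoint size)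
      (λ (_ , _ , star) → IsTwin2StarAt.size star)
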